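{- Assume $\mathsf{CT_Q}$. There are predicates $A,B:\mathbb{N}\to\mathbb{P}$ that are both enumerable and form an inseparable pair.
   Context: Meta-theory: constructive type theory (Calculus of Inductive Constructions), no classical axioms. $p:\mathbb{N}\to\mathbb{P}$ is enumerable if there is $f:\mathbb{N}\to\mathcal{O}(\mathbb{N})$ with $\forall x.\ p\,x\leftrightarrow\exists n.\ f\,n=\mathsf{Some}\,x$; $D$ is decidable if $\exists f:\mathbb{N}\to\mathbb{B}.\ \forall x.\ D\,x\leftrightarrow f\,x=\mathsf{tt}$, and undecidable means not decidable. A pair $A,B$ is inseparable if $A,B$ are disjoint ($\neg(A\,n\land B\,n)$ for all $n$) and every $D:\mathbb{N}\to\mathbb{P}$ with $\forall n.\ A\,n\to D\,n$ and $\forall n.\ B\,n\to\neg D\,n$ is undecidable. $\mathsf{Q}$ is Robinson arithmetic in signature $0,S,+,\times,=$ with intuitionistic natural deduction; $\overline{n}=S^n0$. $\Delta_1$: for every substitution $\sigma$ of closed terms $\mathsf{Q}\vdash\varphi[\sigma]$ or $\mathsf{Q}\vdash\neg\varphi[\sigma]$; $\Sigma_1$: $\exists x_1\dots\exists x_n.\varphi_0$ with $\varphi_0$ $\Delta_1$. $\mathsf{CT_Q}$: for every $f:\mathbb{N}\to\mathbb{N}$ there is a binary $\Sigma_1$-formula $\varphi_f(x,y)$ with $\mathsf{Q}\vdash\forall y.\,\varphi_f(\overline{n},y)\leftrightarrow\overline{f\,n}=y$ for every $n$. -}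

module Defs where

open import Data.Nat using (ℕ; zero; suc; _<_)
open import Data.Bool using (Bool; true)
open import Data.Maybe using (Maybe; just)
open import Data.List using (List; []; _∷_; map)
open import Data.List.Membership.Propositional using (_∈_)
open import Data.Product using (Σ; _×_; ∃)
open import Data.Sum using (_⊎_)
open import Relation.Nullary using (¬_)
open import Relation.Binary.PropositionalEquality using (_≡_)
open import Function.Bundles using (_⇔_)

Enumerable : (ℕ → Set) → Set
Enumerable p = Σ (ℕ → Maybe ℕ) λ f → ∀ x → p x ⇔ ∃ λ n → f n ≡ just x

Decidable : (ℕ → Set) → Set
Decidable D = Σ (ℕ → Bool) λ f → ∀ x → D x ⇔ (f x ≡ true)

Undecidable : (ℕ → Set) → Set
Undecidable D = ¬ Decidable D

Disjoint : (ℕ → Set) → (ℕ → Set) → Set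
Disjoint A B = ∀ n → ¬ (A n × B n)

Inseparable : (ℕ → Set) → (ℕ → Set) → Set₁
Inseparable A B =
  Disjoint A B ×
  (∀ (D : ℕ → Set) → (∀ n → A n → D n) → (∀ n → B n → ¬ D n) → Undecidable D)

infixl 7 _⊗_
infixl 6 _⊕_
infix  5 _==_
infixr 4 _∧'_
infixr 3 _∨'_
infixr 2 _⇒_

data Term : Set where
  var  : ℕ → Term
  zer  : Term
  sc   : Term → Term
  _⊕_  : Term → Term → Term
  _⊗_  : Term → Term → Term

data Form : Set where
  ⊥'   : Form
  _==_ : Term → Term → Form
  _∧'_ : Form → Form → Form
  _∨'_ : Form → Form → Form
  _⇒_  : Form → Form → Form
  ∀'   : Form → Form
  ∃'   : Form → Form

¬' : Form → Form
¬' φ = φ ⇒ ⊥'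

_⇔'_ : Form → Form → Form
φ ⇔' ψ = (φ ⇒ ψ) ∧' (ψ ⇒ φ)

num : ℕ → Term
num zero    = zer
num (suc n) = sc (num n)

Subst : Set
Subst = ℕ → Term

_[_]ₜ : Term → Subst → Term
var n   [ σ ]ₜ = σ n
zer     [ σ ]ₜ = zer
sc t    [ σ ]ₜ = sc (t [ σ ]ₜ)
(s ⊕ t) [ σ ]ₜ = (s [ σ ]ₜ) ⊕ (t [ σ ]ₜ)
(s ⊗ t) [ σ ]ₜ = (s [ σ ]ₜ) ⊗ (t [ σ ]ₜ)

↑ : Subst
↑ n = var (suc n)

_∙_ : Term → Subst → Subst
(t ∙ σ) zero    = t
(t ∙ σ) (suc n) = σ n

up : Subst → Subst
up σ zero    = var zero
up σ (suc n) = σ n [ ↑ ]ₜ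

_[_] : Form → Subst → Form
⊥'       [ σ ] = ⊥'
(s == t) [ σ ] = (s [ σ ]ₜ) == (t [ σ ]ₜ)
(φ ∧' ψ) [ σ ] = (φ [ σ ]) ∧' (ψ [ σ ])
(φ ∨' ψ) [ σ ] = (φ [ σ ]) ∨' (ψ [ σ ])
(φ ⇒ ψ)  [ σ ] = (φ [ σ ]) ⇒ (ψ [ σ ])
∀' φ     [ σ ] = ∀' (φ [ up σ ])
∃' φ     [ σ ] = ∃' (φ [ up σ ])

data BoundedT (k : ℕ) : Term → Set where
  bvar : ∀ {n} → n < k → BoundedT k (var n)
  bzer : BoundedT k zer
  bsc  : ∀ {t} → BoundedT k t → BoundedT k (sc t)
  bplus : ∀ {s t} → BoundedT k s → BoundedT k t → BoundedT k (s ⊕ t)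
  bmult : ∀ {s t} → BoundedT k s → BoundedT k t → BoundedT k (s ⊗ t)

data Bounded : ℕ → Form → Set where
  bfal : ∀ {k} → Bounded k ⊥'
  beq  : ∀ {k s t} → BoundedT k s → BoundedT k t → Bounded k (s == t)
  band : ∀ {k φ ψ} → Bounded k φ → Bounded k ψ → Bounded k (φ ∧' ψ)
  bor  : ∀ {k φ ψ} → Bounded k φ → Bounded k ψ → Bounded k (φ ∨' ψ)
  bimp : ∀ {k φ ψ} → Bounded k φ → Bounded k ψ → Bounded k (φ ⇒ ψ)
  ball : ∀ {k φ} → Bounded (suc k) φ → Bounded k (∀' φ)
  bex  : ∀ {k φ} → Bounded (suc k) φ → Bounded k (∃' φ)

ClosedT : Term → Set
ClosedT = BoundedT 0

infix 1 _⊢_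

data _⊢_ : List Form → Form → Set where
  ctx  : ∀ {Γ φ} → φ ∈ Γ → Γ ⊢ φ
  impI : ∀ {Γ φ ψ} → (φ ∷ Γ) ⊢ ψ → Γ ⊢ φ ⇒ ψ
  impE : ∀ {Γ φ ψ} → Γ ⊢ φ ⇒ ψ → Γ ⊢ φ → Γ ⊢ ψ
  allI : ∀ {Γ φ} → map (_[ ↑ ]) Γ ⊢ φ → Γ ⊢ ∀' φ
  allE : ∀ {Γ φ} (t : Term) → Γ ⊢ ∀' φ → Γ ⊢ φ [ t ∙ var ]
  exI  : ∀ {Γ φ} (t : Term) → Γ ⊢ φ [ t ∙ var ] → Γ ⊢ ∃' φ
  exE  : ∀ {Γ φ ψ} → Γ ⊢ ∃' φ → (φ ∷ map (_[ ↑ ]) Γ) ⊢ ψ [ ↑ ] → Γ ⊢ ψ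
  exp  : ∀ {Γ φ} → Γ ⊢ ⊥' → Γ ⊢ φ
  conI : ∀ {Γ φ ψ} → Γ ⊢ φ → Γ ⊢ ψ → Γ ⊢ φ ∧' ψ
  conE₁ : ∀ {Γ φ ψ} → Γ ⊢ φ ∧' ψ → Γ ⊢ φ
  conE₂ : ∀ {Γ φ ψ} → Γ ⊢ φ ∧' ψ → Γ ⊢ ψ
  disI₁ : ∀ {Γ φ ψ} → Γ ⊢ φ → Γ ⊢ φ ∨' ψ
  disI₂ : ∀ {Γ φ ψ} → Γ ⊢ ψ → Γ ⊢ φ ∨' ψ
  disE  : ∀ {Γ φ ψ θ} → Γ ⊢ φ ∨' ψ → (φ ∷ Γ) ⊢ θ → (ψ ∷ Γ) ⊢ θ → Γ ⊢ θ

-- Robinson arithmetic Q (including the equality axioms, since = is a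
-- symbol of the signature and the calculus has no built-in equality rules)

private
  v0 v1 v2 v3 : Term
  v0 = var 0
  v1 = var 1
  v2 = var 2
  v3 = var 3

Q : List Form
Q =
    ∀' (v0 == v0)
  ∷ ∀' (∀' (v1 == v0 ⇒ v0 == v1))
  ∷ ∀' (∀' (∀' (v2 == v1 ⇒ v1 == v0 ⇒ v2 == v0)))
  ∷ ∀' (∀' (v1 == v0 ⇒ sc v1 == sc v0))
  ∷ ∀' (∀' (∀' (∀' (v3 == v1 ⇒ v2 == v0 ⇒ v3 ⊕ v2 == v1 ⊕ v0))))
  ∷ ∀' (∀' (∀' (∀' (v3 == v1 ⇒ v2 == v0 ⇒ v3 ⊗ v2 == v1 ⊗ v0))))
  ∷ ∀' (¬' (zer == sc v0))
  ∷ ∀' (∀' (sc v1 == sc v0 ⇒ v1 == v0))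
  ∷ ∀' (v0 ⊕ zer == v0)
  ∷ ∀' (∀' (v1 ⊕ sc v0 == sc (v1 ⊕ v0)))
  ∷ ∀' (v0 ⊗ zer == zer)
  ∷ ∀' (∀' (v1 ⊗ sc v0 == v1 ⊗ v0 ⊕ v1))
  ∷ ∀' (v0 == zer ∨' ∃' (v1 == sc v0))
  ∷ []

Δ₁ : Form → Set
Δ₁ φ = ∀ (σ : Subst) → (∀ n → ClosedT (σ n)) → (Q ⊢ φ [ σ ]) ⊎ (Q ⊢ ¬' (φ [ σ ]))

data Σ₁ : Form → Set where
  base : ∀ {φ} → Δ₁ φ → Σ₁ φ
  ex   : ∀ {φ} → Σ₁ φ → Σ₁ (∃' φ)

-- Church's thesis for Q.  A binary formula φ(x,y) has free variables
-- among var 1 (= x) and var 0 (= y).  "∀y. φ(n̄, y) ↔ f n = y" is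
-- ∀' (φ [ up (num n ∙ var) ] ⇔' (num (f n) == var 0)).

CT-Q : Set
CT-Q = ∀ (f : ℕ → ℕ) → Σ Form λ φ →
         Bounded 2 φ × Σ₁ φ ×
         (∀ n → Q ⊢ ∀' ((φ [ up (num n ∙ var) ]) ⇔' (num (f n) == var 0)))

-- Take A = SelfValue 0 and B = SelfValue 1, where SelfValue m is the set of codes c such that
-- Q proves that the c-th formula, read as a function graph, sends c to m. Provability in Q is
-- enumerable (derivations are recovered by a checker from enumerable proof skeletons), so A and
-- B are enumerable; since Q is sound in ℕ, provable graphs are functional, so A and B are
-- disjoint. If a decidable D separated them, CT_Q would give a formula computing
-- c ↦ (if D c then 1 else 0); at its own code c this formula would put c into A ∖ D or B ∩ D.

module Submission where

open import Defs
open import Data.Bool using (Bool; true; false; if_then_else_)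
open import Data.Empty using (⊥; ⊥-elim)
open import Data.List using (List; []; _∷_; _++_; map; head; drop; cartesianProductWith)
open import Data.List.Membership.Propositional using (_∈_)
open import Data.List.Membership.Propositional.Properties using (∈-++⁺ˡ; ∈-++⁺ʳ; ∈-cartesianProductWith⁺)
open import Data.List.Relation.Unary.All using (All; []; _∷_)
import Data.List.Relation.Unary.All as All
import Data.List.Relation.Unary.All.Properties as All
open import Data.List.Relation.Unary.Any using (here; there)
open import Data.Maybe using (Maybe; just; nothing; _>>=_; is-just; maybe′)
open import Data.Maybe.Properties using (just-injective)
import Data.Maybe.Effectful
open import Effect.Applicative using (RawApplicative)
open import Level using (0ℓ)
open import Data.Nat using (ℕ; zero; suc; _+_; _*_; _≤_; _≤′_; ≤′-refl; ≤′-step; _⊔_) renaming (_≟_ to _≟ℕ_)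
open import Data.Nat.Properties using (+-suc; +-identityʳ; +-comm; *-suc; *-zeroʳ; suc-injective; ≤⇒≤′; m≤m⊔n; m≤n⊔m)
open import Data.Product using (Σ; _×_; ∃; _,_; proj₁; proj₂)
import Data.Product.Function.Dependent.Propositional as Σ
open import Data.Product.Function.NonDependent.Propositional using (_×-⇔_)
open import Data.Sum using (_⊎_; inj₁; inj₂)
open import Data.Sum.Function.Propositional using (_⊎-⇔_)
open import Function using (_∘_; case_of_)
open import Function.Bundles using (_⇔_; mk⇔; Equivalence)
open import Function.Construct.Identity using (⇔-id)
open import Function.Related.TypeIsomorphisms using (→-cong-⇔)
open import Relation.Binary using (DecidableEquality)
open import Relation.Binary.PropositionalEquality using (_≡_; refl; sym; trans; cong; cong₂; subst; subst₂; module ≡-Reasoning)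
open import Relation.Nullary using (¬_; yes; no)
open import Relation.Nullary.Decidable using (map′; _×-dec_; dec⇒maybe)

open RawApplicative (Data.Maybe.Effectful.applicative {0ℓ}) using (_<$>_; _<*>_)

record Enumerator (X : Set) : Set where
  field
    enum : ℕ → Maybe X
    enum-surjective : ∀ x → ∃ λ n → enum n ≡ just x

open Enumerator

-- Cantor's enumeration of ℕ × ℕ, walking each diagonal a + b = s from (s , 0) down to (0 , s).
nextPair : ℕ × ℕ → ℕ × ℕ
nextPair (zero  , b) = suc b , zero
nextPair (suc a , b) = a , suc b

unpair : ℕ → ℕ × ℕ
unpair zero    = zero , zero
unpair (suc n) = nextPair (unpair n)

Reached : ℕ × ℕ → Set
Reached p = ∃ λ n → unpair n ≡ p

reached-next : ∀ {p} → Reached p → Reached (nextPair p)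
reached-next (n , p) = suc n , cong nextPair p

reached-down : ∀ a b → Reached (a + b , zero) → Reached (a , b)
reached-down a zero    r = subst (λ s → Reached (s , zero)) (+-identityʳ a) r
reached-down a (suc b) r =
  reached-next (reached-down (suc a) b (subst (λ s → Reached (s , zero)) (+-suc a b) r))

reached-axis : ∀ s → Reached (s , zero)
reached-axis zero    = zero , refl
reached-axis (suc s) = reached-next (reached-down zero s (reached-axis s))

unpair-surjective : ∀ a b → Reached (a , b)
unpair-surjective a b = reached-down a b (reached-axis (a + b))

∈⇒head-drop : {X : Set} {x : X} {xs : List X} → x ∈ xs → ∃ λ i → head (drop i xs) ≡ just x
∈⇒head-drop (here refl) = zero , refl
∈⇒head-drop (there p) with ∈⇒head-drop p
... | i , q = suc i , q

listing⇒enumerator : {X : Set} (L : ℕ → List X) → (∀ x → ∃ λ k → x ∈ L k) → Enumerator X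
listing⇒enumerator {X} L complete = record { enum = at ∘ unpair ; enum-surjective = surjective }
  where
  at : ℕ × ℕ → Maybe X
  at (k , i) = head (drop i (L k))

  surjective : ∀ x → ∃ λ n → at (unpair n) ≡ just x
  surjective x with complete x
  ... | k , x∈Lk with ∈⇒head-drop x∈Lk
  ... | i , q with unpair-surjective k i
  ... | n , p = n , trans (cong at p) q

enumerable-by-certificates : {C : Set} {p : ℕ → Set} → Enumerator C → (verify : ℕ → C → Bool) →
                             (∀ x → p x ⇔ ∃ λ c → verify x c ≡ true) → Enumerable p
enumerable-by-certificates {C} {p} C-enum verify p⇔certified = f ∘ unpair , λ x → mk⇔ (to x) (from x)
  where
  accept : ℕ → Maybe C → Maybe ℕ
  accept x (just c) = if verify x c then just x else nothing
  accept x nothing  = nothing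

  f : ℕ × ℕ → Maybe ℕ
  f (x , k) = accept x (enum C-enum k)

  to : ∀ x → p x → ∃ λ n → f (unpair n) ≡ just x
  to x px with Equivalence.to (p⇔certified x) px
  ... | c , verified with enum-surjective C-enum c
  ... | k , k↦c with unpair-surjective x k
  ... | n , n↦xk = n , (begin
    f (unpair n)                                 ≡⟨ cong f n↦xk ⟩
    accept x (enum C-enum k)                     ≡⟨ cong (accept x) k↦c ⟩
    (if verify x c then just x else nothing)     ≡⟨ cong (if_then just x else nothing) verified ⟩
    just x                                       ∎)
    where open ≡-Reasoning

  from : ∀ x → (∃ λ n → f (unpair n) ≡ just x) → p x
  from x (n , fn≡x) with unpair n
  ... | y , k with enum C-enum k
  ... | just c with verify y c in verified
  from x (n , refl) | y , k | just c | true = Equivalence.from (p⇔certified y) (c , verified)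

infixr 5 _▸_

data Tree : Set where
  leaf : ℕ → Tree
  _▸_  : Tree → Tree → Tree

_≟Tree_ : DecidableEquality Tree
leaf m  ≟Tree leaf n  = map′ (cong leaf) (λ { refl → refl }) (m ≟ℕ n)
leaf _  ≟Tree (_ ▸ _) = no λ ()
(_ ▸ _) ≟Tree leaf _  = no λ ()
(s ▸ t) ≟Tree (u ▸ v) = map′ (λ (p , q) → cong₂ _▸_ p q) (λ { refl → refl , refl }) (s ≟Tree u ×-dec t ≟Tree v)

-- trees k lists every tree of height below k all of whose leaves are below k.
trees : ℕ → List Tree
trees zero    = []
trees (suc k) = trees k ++ leaf k ∷ cartesianProductWith _▸_ (trees k) (trees k)

trees-mono : ∀ {m n t} → m ≤ n → t ∈ trees m → t ∈ trees n
trees-mono m≤n = go (≤⇒≤′ m≤n)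
  where
  go : ∀ {m n t} → m ≤′ n → t ∈ trees m → t ∈ trees n
  go ≤′-refl       t∈ = t∈
  go (≤′-step m≤n) t∈ = ∈-++⁺ˡ (go m≤n t∈)

trees-complete : ∀ t → ∃ λ k → t ∈ trees k
trees-complete (leaf n) = suc n , ∈-++⁺ʳ (trees n) (here refl)
trees-complete (s ▸ t) with trees-complete s | trees-complete t
... | i , s∈ | j , t∈ = suc (i ⊔ j) , ∈-++⁺ʳ (trees (i ⊔ j)) (there
      (∈-cartesianProductWith⁺ _▸_ (trees-mono (m≤m⊔n i j) s∈) (trees-mono (m≤n⊔m i j) t∈)))

tree-enumerator : Enumerator Tree
tree-enumerator = listing⇒enumerator trees trees-complete

module Retract {X : Set} (encode : X → Tree) (decode : Tree → Maybe X)
                (decode-encode : ∀ x → decode (encode x) ≡ just x) where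

  encode-injective : ∀ {x y} → encode x ≡ encode y → x ≡ y
  encode-injective {x} {y} p = just-injective (begin
    just x             ≡⟨ sym (decode-encode x) ⟩
    decode (encode x)  ≡⟨ cong decode p ⟩
    decode (encode y)  ≡⟨ decode-encode y ⟩
    just y             ∎)
    where open ≡-Reasoning

  _≟_ : DecidableEquality X
  x ≟ y = map′ encode-injective (cong encode) (encode x ≟Tree encode y)

  enumerator : Enumerator X
  enumerator .enum n = enum tree-enumerator n >>= decode
  enumerator .enum-surjective x with enum-surjective tree-enumerator (encode x)
  ... | n , p = n , trans (cong (_>>= decode) p) (decode-encode x)

encodeTerm : Term → Tree
encodeTerm zer     = leaf 0
encodeTerm (var n) = leaf 0 ▸ leaf n
encodeTerm (sc t)  = leaf 1 ▸ encodeTerm t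
encodeTerm (s ⊕ t) = leaf 2 ▸ encodeTerm s ▸ encodeTerm t
encodeTerm (s ⊗ t) = leaf 3 ▸ encodeTerm s ▸ encodeTerm t

decodeTerm : Tree → Maybe Term
decodeTerm (leaf 0)          = just zer
decodeTerm (leaf 0 ▸ leaf n) = just (var n)
decodeTerm (leaf 1 ▸ a)      = sc <$> decodeTerm a
decodeTerm (leaf 2 ▸ a ▸ b)  = _⊕_ <$> decodeTerm a <*> decodeTerm b
decodeTerm (leaf 3 ▸ a ▸ b)  = _⊗_ <$> decodeTerm a <*> decodeTerm b
decodeTerm _                 = nothing

decode-encodeTerm : ∀ t → decodeTerm (encodeTerm t) ≡ just t
decode-encodeTerm zer     = refl
decode-encodeTerm (var n) = refl
decode-encodeTerm (sc t)  rewrite decode-encodeTerm t = refl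
decode-encodeTerm (s ⊕ t) rewrite decode-encodeTerm s | decode-encodeTerm t = refl
decode-encodeTerm (s ⊗ t) rewrite decode-encodeTerm s | decode-encodeTerm t = refl

encodeForm : Form → Tree
encodeForm ⊥'       = leaf 0
encodeForm (s == t) = leaf 0 ▸ encodeTerm s ▸ encodeTerm t
encodeForm (φ ∧' ψ) = leaf 1 ▸ encodeForm φ ▸ encodeForm ψ
encodeForm (φ ∨' ψ) = leaf 2 ▸ encodeForm φ ▸ encodeForm ψ
encodeForm (φ ⇒ ψ)  = leaf 3 ▸ encodeForm φ ▸ encodeForm ψ
encodeForm (∀' φ)   = leaf 4 ▸ encodeForm φ
encodeForm (∃' φ)   = leaf 5 ▸ encodeForm φ

decodeForm : Tree → Maybe Form
decodeForm (leaf 0)         = just ⊥'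
decodeForm (leaf 0 ▸ a ▸ b) = _==_ <$> decodeTerm a <*> decodeTerm b
decodeForm (leaf 1 ▸ a ▸ b) = _∧'_ <$> decodeForm a <*> decodeForm b
decodeForm (leaf 2 ▸ a ▸ b) = _∨'_ <$> decodeForm a <*> decodeForm b
decodeForm (leaf 3 ▸ a ▸ b) = _⇒_ <$> decodeForm a <*> decodeForm b
decodeForm (leaf 4 ▸ a)     = ∀' <$> decodeForm a
decodeForm (leaf 5 ▸ a)     = ∃' <$> decodeForm a
decodeForm _                = nothing

decode-encodeForm : ∀ φ → decodeForm (encodeForm φ) ≡ just φ
decode-encodeForm ⊥'       = refl
decode-encodeForm (s == t) rewrite decode-encodeTerm s | decode-encodeTerm t = refl
decode-encodeForm (φ ∧' ψ) rewrite decode-encodeForm φ | decode-encodeForm ψ = refl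
decode-encodeForm (φ ∨' ψ) rewrite decode-encodeForm φ | decode-encodeForm ψ = refl
decode-encodeForm (φ ⇒ ψ)  rewrite decode-encodeForm φ | decode-encodeForm ψ = refl
decode-encodeForm (∀' φ)   rewrite decode-encodeForm φ = refl
decode-encodeForm (∃' φ)   rewrite decode-encodeForm φ = refl

open Retract encodeForm decodeForm decode-encodeForm
  using () renaming (_≟_ to _≟Form_; enumerator to form-enumerator)

open import Data.List.Membership.DecPropositional _≟Form_ using (_∈?_)

-- A derivation with its context, conclusion and membership proofs erased; the formulas
-- that the rules do not determine from their conclusion are kept.
data Skeleton : Set where
  hyp : Skeleton
  ⇒I  : Skeleton → Skeleton
  ⇒E  : Form → Skeleton → Skeleton → Skeleton
  ∀I  : Skeleton → Skeleton
  ∀E  : Term → Form → Skeleton → Skeleton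
  ∃I  : Term → Skeleton → Skeleton
  ∃E  : Form → Skeleton → Skeleton → Skeleton
  ⊥E  : Skeleton → Skeleton
  ∧I  : Skeleton → Skeleton → Skeleton
  ∧E₁ : Form → Skeleton → Skeleton
  ∧E₂ : Form → Skeleton → Skeleton
  ∨I₁ : Skeleton → Skeleton
  ∨I₂ : Skeleton → Skeleton
  ∨E  : Form → Form → Skeleton → Skeleton → Skeleton → Skeleton

erase : ∀ {Γ φ} → Γ ⊢ φ → Skeleton
erase (ctx _)                   = hyp
erase (impI d)                  = ⇒I (erase d)
erase (impE {φ = φ} d e)        = ⇒E φ (erase d) (erase e)
erase (allI d)                  = ∀I (erase d)
erase (allE {φ = φ} t d)        = ∀E t φ (erase d)
erase (exI t d)                 = ∃I t (erase d)
erase (exE {φ = φ} d e)         = ∃E φ (erase d) (erase e)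
erase (exp d)                   = ⊥E (erase d)
erase (conI d e)                = ∧I (erase d) (erase e)
erase (conE₁ {ψ = ψ} d)         = ∧E₁ ψ (erase d)
erase (conE₂ {φ = φ} d)         = ∧E₂ φ (erase d)
erase (disI₁ d)                 = ∨I₁ (erase d)
erase (disI₂ d)                 = ∨I₂ (erase d)
erase (disE {φ = φ} {ψ} d e f)  = ∨E φ ψ (erase d) (erase e) (erase f)

check : (Γ : List Form) (φ : Form) → Skeleton → Maybe (Γ ⊢ φ)
check Γ φ        hyp            = ctx <$> dec⇒maybe (φ ∈? Γ)
check Γ (φ ⇒ ψ)  (⇒I P)         = impI <$> check (φ ∷ Γ) ψ P
check Γ ψ        (⇒E φ P R)     = impE <$> check Γ (φ ⇒ ψ) P <*> check Γ φ R
check Γ (∀' φ)   (∀I P)         = allI <$> check (map (_[ ↑ ]) Γ) φ P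
check Γ χ        (∀E t φ P) with (φ [ t ∙ var ]) ≟Form χ
... | yes refl                  = allE t <$> check Γ (∀' φ) P
... | no _                      = nothing
check Γ (∃' φ)   (∃I t P)       = exI t <$> check Γ (φ [ t ∙ var ]) P
check Γ ψ        (∃E φ P R)     = exE <$> check Γ (∃' φ) P <*> check (φ ∷ map (_[ ↑ ]) Γ) (ψ [ ↑ ]) R
check Γ φ        (⊥E P)         = exp <$> check Γ ⊥' P
check Γ (φ ∧' ψ) (∧I P R)       = conI <$> check Γ φ P <*> check Γ ψ R
check Γ φ        (∧E₁ ψ P)      = conE₁ <$> check Γ (φ ∧' ψ) P
check Γ ψ        (∧E₂ φ P)      = conE₂ <$> check Γ (φ ∧' ψ) P
check Γ (φ ∨' ψ) (∨I₁ P)        = disI₁ <$> check Γ φ P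
check Γ (φ ∨' ψ) (∨I₂ P)        = disI₂ <$> check Γ ψ P
check Γ θ        (∨E φ ψ P R S) = disE <$> check Γ (φ ∨' ψ) P <*> check (φ ∷ Γ) θ R <*> check (ψ ∷ Γ) θ S
check _ _        _              = nothing

check-erase : ∀ {Γ φ} (d : Γ ⊢ φ) → ∃ λ d′ → check Γ φ (erase d) ≡ just d′
check-erase {Γ} {φ} (ctx φ∈Γ) with φ ∈? Γ
... | yes φ∈Γ′ = ctx φ∈Γ′ , refl
... | no φ∉Γ   = ⊥-elim (φ∉Γ φ∈Γ)
check-erase (impI d) with check-erase d
... | _ , p rewrite p = _ , refl
check-erase (impE d e) with check-erase d | check-erase e
... | _ , p | _ , q rewrite p | q = _ , refl
check-erase (allI d) with check-erase d
... | _ , p rewrite p = _ , refl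
check-erase (allE {φ = φ} t d) with (φ [ t ∙ var ]) ≟Form (φ [ t ∙ var ]) | check-erase d
... | yes refl | _ , p rewrite p = _ , refl
... | no ≢     | _               = ⊥-elim (≢ refl)
check-erase (exI t d) with check-erase d
... | _ , p rewrite p = _ , refl
check-erase (exE d e) with check-erase d | check-erase e
... | _ , p | _ , q rewrite p | q = _ , refl
check-erase (exp d) with check-erase d
... | _ , p rewrite p = _ , refl
check-erase (conI d e) with check-erase d | check-erase e
... | _ , p | _ , q rewrite p | q = _ , refl
check-erase (conE₁ d) with check-erase d
... | _ , p rewrite p = _ , refl
check-erase (conE₂ d) with check-erase d
... | _ , p rewrite p = _ , refl
check-erase (disI₁ d) with check-erase d
... | _ , p rewrite p = _ , refl
check-erase (disI₂ d) with check-erase d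
... | _ , p rewrite p = _ , refl
check-erase (disE d e f) with check-erase d | check-erase e | check-erase f
... | _ , p | _ , q | _ , r rewrite p | q | r = _ , refl

encodeSkeleton : Skeleton → Tree
encodeSkeleton hyp            = leaf 0
encodeSkeleton (⇒I P)         = leaf 1 ▸ encodeSkeleton P
encodeSkeleton (⇒E φ P R)     = leaf 2 ▸ encodeForm φ ▸ encodeSkeleton P ▸ encodeSkeleton R
encodeSkeleton (∀I P)         = leaf 3 ▸ encodeSkeleton P
encodeSkeleton (∀E t φ P)     = leaf 4 ▸ encodeTerm t ▸ encodeForm φ ▸ encodeSkeleton P
encodeSkeleton (∃I t P)       = leaf 5 ▸ encodeTerm t ▸ encodeSkeleton P
encodeSkeleton (∃E φ P R)     = leaf 6 ▸ encodeForm φ ▸ encodeSkeleton P ▸ encodeSkeleton R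
encodeSkeleton (⊥E P)         = leaf 7 ▸ encodeSkeleton P
encodeSkeleton (∧I P R)       = leaf 8 ▸ encodeSkeleton P ▸ encodeSkeleton R
encodeSkeleton (∧E₁ ψ P)      = leaf 9 ▸ encodeForm ψ ▸ encodeSkeleton P
encodeSkeleton (∧E₂ φ P)      = leaf 10 ▸ encodeForm φ ▸ encodeSkeleton P
encodeSkeleton (∨I₁ P)        = leaf 11 ▸ encodeSkeleton P
encodeSkeleton (∨I₂ P)        = leaf 12 ▸ encodeSkeleton P
encodeSkeleton (∨E φ ψ P R S) =
  leaf 13 ▸ encodeForm φ ▸ encodeForm ψ ▸ encodeSkeleton P ▸ encodeSkeleton R ▸ encodeSkeleton S

decodeSkeleton : Tree → Maybe Skeleton
decodeSkeleton (leaf 0)                 = just hyp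
decodeSkeleton (leaf 1 ▸ a)             = ⇒I <$> decodeSkeleton a
decodeSkeleton (leaf 2 ▸ a ▸ b ▸ c)     = ⇒E <$> decodeForm a <*> decodeSkeleton b <*> decodeSkeleton c
decodeSkeleton (leaf 3 ▸ a)             = ∀I <$> decodeSkeleton a
decodeSkeleton (leaf 4 ▸ a ▸ b ▸ c)     = ∀E <$> decodeTerm a <*> decodeForm b <*> decodeSkeleton c
decodeSkeleton (leaf 5 ▸ a ▸ b)         = ∃I <$> decodeTerm a <*> decodeSkeleton b
decodeSkeleton (leaf 6 ▸ a ▸ b ▸ c)     = ∃E <$> decodeForm a <*> decodeSkeleton b <*> decodeSkeleton c
decodeSkeleton (leaf 7 ▸ a)             = ⊥E <$> decodeSkeleton a
decodeSkeleton (leaf 8 ▸ a ▸ b)         = ∧I <$> decodeSkeleton a <*> decodeSkeleton b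
decodeSkeleton (leaf 9 ▸ a ▸ b)         = ∧E₁ <$> decodeForm a <*> decodeSkeleton b
decodeSkeleton (leaf 10 ▸ a ▸ b)        = ∧E₂ <$> decodeForm a <*> decodeSkeleton b
decodeSkeleton (leaf 11 ▸ a)            = ∨I₁ <$> decodeSkeleton a
decodeSkeleton (leaf 12 ▸ a)            = ∨I₂ <$> decodeSkeleton a
decodeSkeleton (leaf 13 ▸ a ▸ b ▸ c ▸ d ▸ e) =
  ∨E <$> decodeForm a <*> decodeForm b <*> decodeSkeleton c <*> decodeSkeleton d <*> decodeSkeleton e
decodeSkeleton _                        = nothing

decode-encodeSkeleton : ∀ P → decodeSkeleton (encodeSkeleton P) ≡ just P
decode-encodeSkeleton hyp = refl
decode-encodeSkeleton (⇒I P)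
  rewrite decode-encodeSkeleton P = refl
decode-encodeSkeleton (⇒E φ P R)
  rewrite decode-encodeForm φ | decode-encodeSkeleton P | decode-encodeSkeleton R = refl
decode-encodeSkeleton (∀I P)
  rewrite decode-encodeSkeleton P = refl
decode-encodeSkeleton (∀E t φ P)
  rewrite decode-encodeTerm t | decode-encodeForm φ | decode-encodeSkeleton P = refl
decode-encodeSkeleton (∃I t P)
  rewrite decode-encodeTerm t | decode-encodeSkeleton P = refl
decode-encodeSkeleton (∃E φ P R)
  rewrite decode-encodeForm φ | decode-encodeSkeleton P | decode-encodeSkeleton R = refl
decode-encodeSkeleton (⊥E P)
  rewrite decode-encodeSkeleton P = refl
decode-encodeSkeleton (∧I P R)
  rewrite decode-encodeSkeleton P | decode-encodeSkeleton R = refl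
decode-encodeSkeleton (∧E₁ ψ P)
  rewrite decode-encodeForm ψ | decode-encodeSkeleton P = refl
decode-encodeSkeleton (∧E₂ φ P)
  rewrite decode-encodeForm φ | decode-encodeSkeleton P = refl
decode-encodeSkeleton (∨I₁ P)
  rewrite decode-encodeSkeleton P = refl
decode-encodeSkeleton (∨I₂ P)
  rewrite decode-encodeSkeleton P = refl
decode-encodeSkeleton (∨E φ ψ P R S)
  rewrite decode-encodeForm φ | decode-encodeForm ψ
        | decode-encodeSkeleton P | decode-encodeSkeleton R | decode-encodeSkeleton S = refl

skeleton-enumerator : Enumerator Skeleton
skeleton-enumerator = Retract.enumerator encodeSkeleton decodeSkeleton decode-encodeSkeleton

Env : Set
Env = ℕ → ℕ

_∷ₑ_ : ℕ → Env → Env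
(a ∷ₑ ρ) zero    = a
(a ∷ₑ ρ) (suc n) = ρ n

⟦_⟧ₜ : Term → Env → ℕ
⟦ var n ⟧ₜ ρ = ρ n
⟦ zer   ⟧ₜ ρ = zero
⟦ sc t  ⟧ₜ ρ = suc (⟦ t ⟧ₜ ρ)
⟦ s ⊕ t ⟧ₜ ρ = ⟦ s ⟧ₜ ρ + ⟦ t ⟧ₜ ρ
⟦ s ⊗ t ⟧ₜ ρ = ⟦ s ⟧ₜ ρ * ⟦ t ⟧ₜ ρ

⟦_⟧ : Form → Env → Set
⟦ ⊥'     ⟧ ρ = ⊥
⟦ s == t ⟧ ρ = ⟦ s ⟧ₜ ρ ≡ ⟦ t ⟧ₜ ρ
⟦ φ ∧' ψ ⟧ ρ = ⟦ φ ⟧ ρ × ⟦ ψ ⟧ ρ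
⟦ φ ∨' ψ ⟧ ρ = ⟦ φ ⟧ ρ ⊎ ⟦ ψ ⟧ ρ
⟦ φ ⇒ ψ  ⟧ ρ = ⟦ φ ⟧ ρ → ⟦ ψ ⟧ ρ
⟦ ∀' φ   ⟧ ρ = ∀ a → ⟦ φ ⟧ (a ∷ₑ ρ)
⟦ ∃' φ   ⟧ ρ = ∃ λ a → ⟦ φ ⟧ (a ∷ₑ ρ)

⟦num⟧ : ∀ n ρ → ⟦ num n ⟧ₜ ρ ≡ n
⟦num⟧ zero    ρ = refl
⟦num⟧ (suc n) ρ = cong suc (⟦num⟧ n ρ)

_⊨_≔_ : Env → Subst → Env → Set
ρ ⊨ σ ≔ ρ′ = ∀ n → ⟦ σ n ⟧ₜ ρ ≡ ρ′ n

⟦⟧ₜ-subst : ∀ t {σ ρ ρ′} → ρ ⊨ σ ≔ ρ′ → ⟦ t [ σ ]ₜ ⟧ₜ ρ ≡ ⟦ t ⟧ₜ ρ′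
⟦⟧ₜ-subst (var n) σ≔ = σ≔ n
⟦⟧ₜ-subst zer     σ≔ = refl
⟦⟧ₜ-subst (sc t)  σ≔ = cong suc (⟦⟧ₜ-subst t σ≔)
⟦⟧ₜ-subst (s ⊕ t) σ≔ = cong₂ _+_ (⟦⟧ₜ-subst s σ≔) (⟦⟧ₜ-subst t σ≔)
⟦⟧ₜ-subst (s ⊗ t) σ≔ = cong₂ _*_ (⟦⟧ₜ-subst s σ≔) (⟦⟧ₜ-subst t σ≔)

↑-shifts : ∀ a ρ → (a ∷ₑ ρ) ⊨ ↑ ≔ ρ
↑-shifts a ρ n = refl

up-lifts : ∀ {σ ρ ρ′} a → ρ ⊨ σ ≔ ρ′ → (a ∷ₑ ρ) ⊨ up σ ≔ (a ∷ₑ ρ′)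
up-lifts a σ≔ zero    = refl
up-lifts {σ} {ρ} a σ≔ (suc n) = trans (⟦⟧ₜ-subst (σ n) (↑-shifts a ρ)) (σ≔ n)

Π-cong-⇔ : {A B : ℕ → Set} → (∀ a → A a ⇔ B a) → (∀ a → A a) ⇔ (∀ a → B a)
Π-cong-⇔ A⇔B = mk⇔ (λ f a → Equivalence.to (A⇔B a) (f a)) (λ g a → Equivalence.from (A⇔B a) (g a))

⟦⟧-subst : ∀ φ {σ ρ ρ′} → ρ ⊨ σ ≔ ρ′ → ⟦ φ [ σ ] ⟧ ρ ⇔ ⟦ φ ⟧ ρ′
⟦⟧-subst ⊥'       σ≔ = ⇔-id _
⟦⟧-subst (s == t) σ≔ = mk⇔ (subst₂ _≡_ (⟦⟧ₜ-subst s σ≔) (⟦⟧ₜ-subst t σ≔))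
                             (subst₂ _≡_ (sym (⟦⟧ₜ-subst s σ≔)) (sym (⟦⟧ₜ-subst t σ≔)))
⟦⟧-subst (φ ∧' ψ) σ≔ = ⟦⟧-subst φ σ≔ ×-⇔ ⟦⟧-subst ψ σ≔
⟦⟧-subst (φ ∨' ψ) σ≔ = ⟦⟧-subst φ σ≔ ⊎-⇔ ⟦⟧-subst ψ σ≔
⟦⟧-subst (φ ⇒ ψ)  σ≔ = →-cong-⇔ (⟦⟧-subst φ σ≔) (⟦⟧-subst ψ σ≔)
⟦⟧-subst (∀' φ)   σ≔ = Π-cong-⇔ λ a → ⟦⟧-subst φ (up-lifts a σ≔)
⟦⟧-subst (∃' φ)   σ≔ = Σ.congˡ λ {a} → ⟦⟧-subst φ (up-lifts a σ≔)

⟦⟧-shift : ∀ φ a ρ → ⟦ φ [ ↑ ] ⟧ (a ∷ₑ ρ) ⇔ ⟦ φ ⟧ ρ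
⟦⟧-shift φ a ρ = ⟦⟧-subst φ (↑-shifts a ρ)

⟦⟧-inst : ∀ φ t ρ → ⟦ φ [ t ∙ var ] ⟧ ρ ⇔ ⟦ φ ⟧ (⟦ t ⟧ₜ ρ ∷ₑ ρ)
⟦⟧-inst φ t ρ = ⟦⟧-subst φ λ { zero → refl ; (suc n) → refl }

_⊨_ : Env → List Form → Set
ρ ⊨ Γ = All (λ ψ → ⟦ ψ ⟧ ρ) Γ

⊨-shift : ∀ {Γ ρ} a → ρ ⊨ Γ → (a ∷ₑ ρ) ⊨ map (_[ ↑ ]) Γ
⊨-shift {ρ = ρ} a ρ⊨Γ = All.map⁺ (All.map (λ {ψ} → Equivalence.from (⟦⟧-shift ψ a ρ)) ρ⊨Γ)

sound : ∀ {Γ φ} → Γ ⊢ φ → ∀ ρ → ρ ⊨ Γ → ⟦ φ ⟧ ρ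
sound (ctx φ∈Γ)          ρ ρ⊨Γ = All.lookup ρ⊨Γ φ∈Γ
sound (impI d)           ρ ρ⊨Γ = λ x → sound d ρ (x ∷ ρ⊨Γ)
sound (impE d e)         ρ ρ⊨Γ = sound d ρ ρ⊨Γ (sound e ρ ρ⊨Γ)
sound (allI d)           ρ ρ⊨Γ = λ a → sound d (a ∷ₑ ρ) (⊨-shift a ρ⊨Γ)
sound (allE {φ = φ} t d) ρ ρ⊨Γ = Equivalence.from (⟦⟧-inst φ t ρ) (sound d ρ ρ⊨Γ (⟦ t ⟧ₜ ρ))
sound (exI {φ = φ} t d)  ρ ρ⊨Γ = ⟦ t ⟧ₜ ρ , Equivalence.to (⟦⟧-inst φ t ρ) (sound d ρ ρ⊨Γ)
sound (exE {ψ = ψ} d e)  ρ ρ⊨Γ with sound d ρ ρ⊨Γ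
... | a , x = Equivalence.to (⟦⟧-shift ψ a ρ) (sound e (a ∷ₑ ρ) (x ∷ ⊨-shift a ρ⊨Γ))
sound (exp d)            ρ ρ⊨Γ = ⊥-elim (sound d ρ ρ⊨Γ)
sound (conI d e)         ρ ρ⊨Γ = sound d ρ ρ⊨Γ , sound e ρ ρ⊨Γ
sound (conE₁ d)          ρ ρ⊨Γ = proj₁ (sound d ρ ρ⊨Γ)
sound (conE₂ d)          ρ ρ⊨Γ = proj₂ (sound d ρ ρ⊨Γ)
sound (disI₁ d)          ρ ρ⊨Γ = inj₁ (sound d ρ ρ⊨Γ)
sound (disI₂ d)          ρ ρ⊨Γ = inj₂ (sound d ρ ρ⊨Γ)
sound (disE d e f)       ρ ρ⊨Γ with sound d ρ ρ⊨Γ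
... | inj₁ x = sound e ρ (x ∷ ρ⊨Γ)
... | inj₂ y = sound f ρ (y ∷ ρ⊨Γ)

⊨Q : ∀ ρ → ρ ⊨ Q
⊨Q ρ = (λ a → refl)
     ∷ (λ a b → sym)
     ∷ (λ a b c → trans)
     ∷ (λ a b → cong suc)
     ∷ (λ a b c d → cong₂ _+_)
     ∷ (λ a b c d → cong₂ _*_)
     ∷ (λ a ())
     ∷ (λ a b → suc-injective)
     ∷ +-identityʳ
     ∷ +-suc
     ∷ *-zeroʳ
     ∷ (λ a b → trans (*-suc a b) (+-comm a (a * b)))
     ∷ (λ { zero → inj₁ refl ; (suc b) → inj₂ (b , refl) })
     ∷ []

Graph : Form → ℕ → ℕ → Form
Graph φ n m = ∀' ((φ [ up (num n ∙ var) ]) ⇔' (num m == var 0))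

graph-functional : ∀ {φ n m m′} → Q ⊢ Graph φ n m → Q ⊢ Graph φ n m′ → m ≡ m′
graph-functional {φ} {n} {m} {m′} ⊢m ⊢m′ =
  trans (sym (⟦num⟧ m _)) (proj₁ (⊨m m′) (proj₂ (⊨m′ m′) (⟦num⟧ m′ _)))
  where
  ρ : Env
  ρ _ = zero
  ⊨m : ⟦ Graph φ n m ⟧ ρ
  ⊨m = sound ⊢m ρ (⊨Q ρ)
  ⊨m′ : ⟦ Graph φ n m′ ⟧ ρ
  ⊨m′ = sound ⊢m′ ρ (⊨Q ρ)

formAt : ℕ → Maybe Form
formAt = enum form-enumerator

SelfValue : ℕ → ℕ → Set
SelfValue m c = ∃ λ φ → formAt c ≡ just φ × (Q ⊢ Graph φ c m)

verifySelfValue : ℕ → ℕ → Skeleton → Bool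
verifySelfValue m c P = maybe′ (λ φ → is-just (check Q (Graph φ c m) P)) false (formAt c)

selfValue⇔verified : ∀ m c → SelfValue m c ⇔ ∃ λ P → verifySelfValue m c P ≡ true
selfValue⇔verified m c = mk⇔ to from
  where
  to : SelfValue m c → ∃ λ P → verifySelfValue m c P ≡ true
  to (φ , c↦φ , d) with check-erase d
  ... | _ , checked = erase d , trans (cong (maybe′ _ false) c↦φ) (cong is-just checked)

  from : (∃ λ P → verifySelfValue m c P ≡ true) → SelfValue m c
  from (P , verified) with formAt c
  ... | just φ with check Q (Graph φ c m) P
  ...   | just d = φ , refl , d

selfValue-enumerable : ∀ m → Enumerable (SelfValue m)
selfValue-enumerable m =
  enumerable-by-certificates skeleton-enumerator (verifySelfValue m) (selfValue⇔verified m)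

selfValue-functional : ∀ {m m′ c} → SelfValue m c → SelfValue m′ c → m ≡ m′
selfValue-functional (φ , c↦φ , ⊢m) (φ′ , c↦φ′ , ⊢m′)
  with just-injective (trans (sym c↦φ) c↦φ′)
... | refl = graph-functional ⊢m ⊢m′

diagonal : CT-Q → (f : ℕ → ℕ) → ∃ λ c → SelfValue (f c) c
diagonal ct f with ct f
... | φ , _ , _ , φ-computes-f with enum-surjective form-enumerator φ
... | c , c↦φ = c , φ , c↦φ , φ-computes-f c

selfValue-inseparable : CT-Q → ∀ (D : ℕ → Set) →
                        (∀ c → SelfValue 0 c → D c) → (∀ c → SelfValue 1 c → ¬ D c) → Undecidable D
selfValue-inseparable ct D A⊆D B⊆∁D (d , d-spec) with diagonal ct (λ c → if d c then 1 else 0)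
... | c , self with d c in dc
... | true  = B⊆∁D c self (Equivalence.from (d-spec c) dc)
... | false with trans (sym dc) (Equivalence.to (d-spec c) (A⊆D c self))
...   | ()

lemma7p7 : CT-Q → Σ (ℕ → Set) λ A → Σ (ℕ → Set) λ B → Enumerable A × Enumerable B × Inseparable A B
lemma7p7 ct =
  SelfValue 0 , SelfValue 1 ,
  selfValue-enumerable 0 , selfValue-enumerable 1 ,
  (λ c (self₀ , self₁) → case selfValue-functional self₀ self₁ of λ ()) ,
  selfValue-inseparable ct
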